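{- Let $\mathbf A = \langle A, \to, 0\rangle$ be an implication zroupoid. Then the algebra $\mathbf A_{mj} = \langle A, \wedge, \vee\rangle$ is a Birkhoff system if and only if $\mathbf A \in \mathcal S$, i.e. if and only if $\mathbf A$ is symmetric.
   Context: An implication zroupoid is an algebra $\mathbf A = \langle A, \to, 0\rangle$, where $\to$ is a binary operation and $0$ is a constant, such that, writing $x' := x \to 0$ (and $x'' := (x')'$), the following hold for all $x,y,z\in A$: (1) $(x \to y) \to z = [(z' \to x) \to (y \to z)']'$, and (2) $0'' = 0$. For an implication zroupoid $\mathbf A$, define on $A$ the operations $x \wedge y := (x \to y')'$ and $x \vee y := (x' \wedge y')'$, and put $\mathbf A_{mj} := \langle A, \wedge, \vee\rangle$. An implication zroupoid $\mathbf A$ is symmetric if it is both involutive ($x'' = x$ for all $x\in A$) and meet-commutative ($x \wedge y = y \wedge x$ for all $x,y\in A$). $\mathcal S$ denotes the variety of symmetric implication zroupoids. A bisemilattice is an algebra $\langle B, \wedge, \vee\rangle$ in which both binary operations $\wedge$ and $\vee$ are associative, commutative and idempotent. A Birkhoff system is a bisemilattice satisfying the Birkhoff identity $x \wedge (x \vee y) = x \vee (x \wedge y)$ for all $x,y$. -}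

module Defs where

open import Level using (Level; suc; _⊔_)
open import Algebra.Core using (Op₁; Op₂)
import Algebra.Definitions
open import Algebra.Lattice.Bundles using (RawLattice)
import Algebra.Lattice.Structures
open import Relation.Binary.Core using (Rel)
open import Relation.Binary.Structures using (IsEquivalence)

private
  variable
    a ℓ : Level

-- The arrow of the zroupoid is written _⇒_, since → is reserved in Agda.
-- As in the library's algebraic bundles, equality is an arbitrary
-- congruence _≈_; taking _≈_ to be _≡_ gives the usual notion.
record ImplicationZroupoid a ℓ : Set (suc (a ⊔ ℓ)) where
  infix  4 _≈_
  infixr 6 _⇒_
  infix  8 _′
  field
    Carrier : Set a
    _≈_     : Rel Carrier ℓ
    _⇒_     : Op₂ Carrier
    0#      : Carrier

  open Algebra.Definitions _≈_

  _′ : Op₁ Carrier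
  x ′ = x ⇒ 0#

  field
    isEquivalence : IsEquivalence _≈_
    ⇒-cong        : Congruent₂ _⇒_
    implication   : ∀ x y z → (x ⇒ y) ⇒ z ≈ (((z ′) ⇒ x) ⇒ ((y ⇒ z) ′)) ′
    0′′≈0         : (0# ′) ′ ≈ 0#

  infixr 7 _∧_
  infixr 6 _∨_

  _∧_ : Op₂ Carrier
  x ∧ y = (x ⇒ (y ′)) ′

  _∨_ : Op₂ Carrier
  x ∨ y = ((x ′) ∧ (y ′)) ′

-- RawLattice is the library's signature of two binary operations; no
-- lattice laws are implied.
_ₘⱼ : ImplicationZroupoid a ℓ → RawLattice a ℓ
A ₘⱼ = record { Carrier = Carrier ; _≈_ = _≈_ ; _∧_ = _∧_ ; _∨_ = _∨_ }
  where open ImplicationZroupoid A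

record IsSymmetric (A : ImplicationZroupoid a ℓ) : Set (a ⊔ ℓ) where
  open ImplicationZroupoid A
  open Algebra.Definitions _≈_
  field
    involutive : Involutive _′
    ∧-comm     : Commutative _∧_

record IsBisemilattice (B : RawLattice a ℓ) : Set (a ⊔ ℓ) where
  open RawLattice B
  open Algebra.Lattice.Structures _≈_
  field
    isMeetSemilattice : IsMeetSemilattice _∧_
    isJoinSemilattice : IsJoinSemilattice _∨_

record IsBirkhoffSystem (B : RawLattice a ℓ) : Set (a ⊔ ℓ) where
  open RawLattice B
  field
    isBisemilattice : IsBisemilattice B
    birkhoff        : ∀ x y → (x ∧ (x ∨ y)) ≈ (x ∨ (x ∧ y))

{-# OPTIONS --safe #-}

-- For an involutive, meet-commutative A, the defining identity says exactly
-- that ∨ distributes over ∧.  So A ₘⱼ with 0 and 0′ is a "bi-distributive"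
-- algebra: two commutative unital operations, each distributing over the
-- other.  Idempotence and Birkhoff's identity are then immediate.
--
-- For associativity of _*_, write c = (x * y) * z and d = x * (y * z).  In a
-- distributive lattice, c + d = ((x + d) * (y + d)) * (z + d) = c by
-- absorption, and d + c = d by symmetry.  Absorption fails here, but
-- x + x * y = x + 0 * y, so x + d, y + d and z + d are only translates of x, y
-- and z by multiples of 0.  Translation by 0 * c is a homomorphism that
-- swallows these translates and fixes both c and c + d.
module Submission where

open import Defs
open import Algebra.Core using (Op₂)
import Algebra.Consequences.Setoid
import Algebra.Definitions
open import Algebra.Structures using (IsCommutativeBand; IsMagma; IsUnitalMagma)
open import Data.Product using (proj₁; proj₂)
open import Function.Bundles using (_⇔_; mk⇔)
open import Level using (Level; _⊔_)
open import Relation.Binary.Bundles using (Setoid)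
open import Relation.Binary.Core using (Rel)
import Relation.Binary.Reasoning.Setoid as ≈-Reasoning

private
  variable
    a ℓ : Level

-- Bidistributive algebras and weak absorption.

record IsBidistributive {A : Set a} (_≈_ : Rel A ℓ) (_+_ _*_ : Op₂ A) (0# 1# : A)
       : Set (a ⊔ ℓ) where
  open Algebra.Definitions _≈_
  field
    +-isUnitalMagma : IsUnitalMagma _≈_ _+_ 0#
    *-isUnitalMagma : IsUnitalMagma _≈_ _*_ 1#
    +-comm          : Commutative _+_
    *-comm          : Commutative _*_
    *-distrib-+     : _*_ DistributesOver _+_
    +-distrib-*     : _+_ DistributesOver _*_

module BidistributiveProperties
  {A : Set a} {_≈_ : Rel A ℓ} {_+_ _*_ : Op₂ A} {0# 1# : A}
  (isBidistributive : IsBidistributive _≈_ _+_ _*_ 0# 1#)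
  where

  open IsBidistributive isBidistributive
  open Algebra.Definitions _≈_ using (Associative; Idempotent)
  open IsUnitalMagma +-isUnitalMagma public
    using (setoid; refl; sym; trans)
    renaming (∙-cong to +-cong; identityˡ to +-identityˡ; identityʳ to +-identityʳ)
  open IsUnitalMagma *-isUnitalMagma public
    using ()
    renaming (∙-cong to *-cong; identityˡ to *-identityˡ; identityʳ to *-identityʳ)
  open ≈-Reasoning setoid

  private
    *-distribˡ = proj₁ *-distrib-+
    *-distribʳ = proj₂ *-distrib-+
    +-distribˡ = proj₁ +-distrib-*
    +-distribʳ = proj₂ +-distrib-*

    +-congˡ : ∀ {x y z} → y ≈ z → (x + y) ≈ (x + z)
    +-congˡ = +-cong refl

    +-congʳ : ∀ {x y z} → y ≈ z → (y + x) ≈ (z + x)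
    +-congʳ p = +-cong p refl

    *-congˡ : ∀ {x y z} → y ≈ z → (x * y) ≈ (x * z)
    *-congˡ = *-cong refl

    *-congʳ : ∀ {x y z} → y ≈ z → (y * x) ≈ (z * x)
    *-congʳ p = *-cong p refl

  xy+x0≈xy : ∀ x y → ((x * y) + (x * 0#)) ≈ (x * y)
  xy+x0≈xy x y = trans (sym (*-distribˡ x y 0#)) (*-congˡ (+-identityʳ y))

  -- Distributing `x` over `1# + 0#`, which is `1#`, leaves this remnant of absorption.
  x+0x≈x : ∀ x → (x + (0# * x)) ≈ x
  x+0x≈x x = begin
    x + (0# * x)        ≈⟨ +-cong (*-identityʳ x) (*-comm x 0#) ⟨
    (x * 1#) + (x * 0#) ≈⟨ xy+x0≈xy x 1# ⟩
    x * 1#              ≈⟨ *-identityʳ x ⟩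
    x                   ∎

  *-idem : Idempotent _*_
  *-idem x = begin
    x * x               ≈⟨ *-cong (+-identityʳ x) (+-identityʳ x) ⟨
    (x + 0#) * (x + 0#) ≈⟨ +-distribˡ x 0# 0# ⟨
    -- `0# * 0#` is `0#`, by `x+0x≈x` at `0#`.
    x + (0# * 0#)       ≈⟨ +-congˡ (trans (sym (+-identityˡ _)) (x+0x≈x 0#)) ⟩
    x + 0#              ≈⟨ +-identityʳ x ⟩
    x                   ∎

  x[x+y]≈x+xy : ∀ x y → (x * (x + y)) ≈ (x + (x * y))
  x[x+y]≈x+xy x y = trans (*-distribˡ x x y) (+-congʳ (*-idem x))

  -- Expanding `x * (x + y)` by either distributive law, with `x` read as `x + 0#` for the second,
  -- gives a substitute for absorption.
  x+xy≈x+0y : ∀ x y → (x + (x * y)) ≈ (x + (0# * y))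
  x+xy≈x+0y x y = begin
    x + (x * y)         ≈⟨ x[x+y]≈x+xy x y ⟨
    x * (x + y)         ≈⟨ *-congʳ (+-identityʳ x) ⟨
    (x + 0#) * (x + y)  ≈⟨ +-distribˡ x 0# y ⟨
    x + (0# * y)        ∎

  -- Translations by multiples of `0#`.

  x[1+y]≈x+0y : ∀ x y → (x * (1# + y)) ≈ (x + (0# * y))
  x[1+y]≈x+0y x y = begin
    x * (1# + y)        ≈⟨ *-distribˡ x 1# y ⟩
    (x * 1#) + (x * y)  ≈⟨ +-congʳ (*-identityʳ x) ⟩
    x + (x * y)         ≈⟨ x+xy≈x+0y x y ⟩
    x + (0# * y)        ∎

  -- Translation by `0# * t` is multiplication by `1# + t`, so it respects `_+_`; it respects `_*_`
  -- directly by `+-distrib-*`.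
  translate-+ : ∀ t x y → ((x + y) + (0# * t)) ≈ ((x + (0# * t)) + (y + (0# * t)))
  translate-+ t x y = begin
    (x + y) + (0# * t)                ≈⟨ x[1+y]≈x+0y (x + y) t ⟨
    (x + y) * (1# + t)                ≈⟨ *-distribʳ (1# + t) x y ⟩
    (x * (1# + t)) + (y * (1# + t))   ≈⟨ +-cong (x[1+y]≈x+0y x t) (x[1+y]≈x+0y y t) ⟩
    (x + (0# * t)) + (y + (0# * t))   ∎

  0[1+x]≈0x : ∀ x → (0# * (1# + x)) ≈ (0# * x)
  0[1+x]≈0x x = trans (x[1+y]≈x+0y 0# x) (+-identityˡ _)

  -- Multiplication by `0#` does not see a summand `1#`, and `1# + (0# * x)` equals `1# + x`.
  0[0x]≈0x : ∀ x → (0# * (0# * x)) ≈ (0# * x)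
  0[0x]≈0x x = begin
    0# * (0# * x)          ≈⟨ 0[1+x]≈0x (0# * x) ⟨
    0# * (1# + (0# * x))   ≈⟨ *-congˡ (x[1+y]≈x+0y 1# x) ⟨
    0# * (1# * (1# + x))   ≈⟨ *-congˡ (*-identityˡ _) ⟩
    0# * (1# + x)          ≈⟨ 0[1+x]≈0x x ⟩
    0# * x                 ∎

  0[x+0y]≈0x+0y : ∀ x y → (0# * (x + (0# * y))) ≈ ((0# * x) + (0# * y))
  0[x+0y]≈0x+0y x y = trans (*-distribˡ 0# x (0# * y)) (+-congˡ (0[0x]≈0x y))

  -- Once the invisible summand `1#` is inserted, `1# + (x * y)` factors as `(1# + x) * (1# + y)`,
  -- which is a translate of `1# + x`.
  0[xy]≈0x+0y : ∀ x y → (0# * (x * y)) ≈ ((0# * x) + (0# * y))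
  0[xy]≈0x+0y x y = begin
    0# * (x * y)                  ≈⟨ 0[1+x]≈0x (x * y) ⟨
    0# * (1# + (x * y))           ≈⟨ *-congˡ (+-distribˡ 1# x y) ⟩
    0# * ((1# + x) * (1# + y))    ≈⟨ *-congˡ (x[1+y]≈x+0y (1# + x) y) ⟩
    0# * ((1# + x) + (0# * y))    ≈⟨ 0[x+0y]≈0x+0y (1# + x) y ⟩
    (0# * (1# + x)) + (0# * y)    ≈⟨ +-congʳ (0[1+x]≈0x x) ⟩
    (0# * x) + (0# * y)           ∎

  x[0y]≈0x+0y : ∀ x y → (x * (0# * y)) ≈ ((0# * x) + (0# * y))
  x[0y]≈0x+0y x y = begin
    x * u                 ≈⟨ *-comm x u ⟩
    -- The summand `u * 0#` is `u` itself, which brings the sum into the form of weak absorption.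
    u * x                 ≈⟨ xy+x0≈xy u x ⟨
    (u * x) + (u * 0#)    ≈⟨ +-congˡ (trans (*-comm u 0#) (0[0x]≈0x y)) ⟩
    (u * x) + u           ≈⟨ +-comm (u * x) u ⟩
    u + (u * x)           ≈⟨ x+xy≈x+0y u x ⟩
    u + (0# * x)          ≈⟨ +-comm u (0# * x) ⟩
    (0# * x) + u          ∎
    where u = 0# * y

  -- Seen as multiplication by `x + 1#`, the translation merges with `x + y` because `_+_`
  -- distributes over `_*_`.
  [x+y]+0x≈x+y : ∀ x y → ((x + y) + (0# * x)) ≈ (x + y)
  [x+y]+0x≈x+y x y = begin
    (x + y) + (0# * x)  ≈⟨ x[1+y]≈x+0y (x + y) x ⟨
    (x + y) * (1# + x)  ≈⟨ *-congˡ (+-comm 1# x) ⟩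
    (x + y) * (x + 1#)  ≈⟨ +-distribˡ x y 1# ⟨
    x + (y * 1#)        ≈⟨ +-congˡ (*-identityʳ y) ⟩
    x + y               ∎

  [x+0y]+0y≈x+0y : ∀ x y → ((x + (0# * y)) + (0# * y)) ≈ (x + (0# * y))
  [x+0y]+0y≈x+0y x y = begin
    (x + u) + u         ≈⟨ +-cong (+-comm x u) (sym (0[0x]≈0x y)) ⟩
    (u + x) + (0# * u)  ≈⟨ [x+y]+0x≈x+y u x ⟩
    u + x               ≈⟨ +-comm u x ⟩
    x + u               ∎
    where u = 0# * y

  -- Associativity of `_+_` is not yet available, so the nested sums are split and regrouped by
  -- `translate-+` until idempotence of translation collapses them.
  [x+0y]+0z≈x+0[yz] : ∀ x y z → ((x + (0# * y)) + (0# * z)) ≈ (x + (0# * (y * z)))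
  [x+0y]+0z≈x+0[yz] x y z = begin
    (x + e) + f               ≈⟨ translate-+ z x e ⟩
    (x + f) + (e + f)         ≈⟨ +-congˡ g≈e+f ⟨
    (x + f) + g               ≈⟨ translate-+ (y * z) x f ⟩
    (x + g) + (f + g)         ≈⟨ +-congˡ f+g≈g ⟩
    (x + g) + g               ≈⟨ [x+0y]+0y≈x+0y x (y * z) ⟩
    x + g                     ∎
    where
    e = 0# * y
    f = 0# * z
    g = 0# * (y * z)

    g≈e+f : g ≈ (e + f)
    g≈e+f = 0[xy]≈0x+0y y z

    f+g≈g : (f + g) ≈ g
    f+g≈g = begin
      f + g         ≈⟨ +-comm f g ⟩
      g + f         ≈⟨ +-congʳ g≈e+f ⟩
      (e + f) + f   ≈⟨ [x+0y]+0y≈x+0y e z ⟩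
      e + f         ≈⟨ g≈e+f ⟨
      g             ∎

  -- Fixed points of translations.

  infix 4 _Absorbs_

  -- The typical case is `t` a factor of `x`; by `x+0x≈x` every element absorbs itself.
  _Absorbs_ : Rel A _
  x Absorbs t = (x + (0# * t)) ≈ x

  absorbs-respˡ : ∀ {t x y} → x ≈ y → x Absorbs t → y Absorbs t
  absorbs-respˡ x≈y p = trans (+-congʳ (sym x≈y)) (trans p x≈y)

  absorbs⇒0x+0t≈0x : ∀ {x t} → x Absorbs t → ((0# * x) + (0# * t)) ≈ (0# * x)
  absorbs⇒0x+0t≈0x {x} {t} p = trans (sym (0[x+0y]≈0x+0y x t)) (*-congˡ p)

  -- Translating both factors fixes `x` and adds `x * (0# * t)` to the product. That term reduces to
  -- `0# * x`, which `x * y` swallows.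
  *-absorbsˡ : ∀ {x t} y → x Absorbs t → (x * y) Absorbs t
  *-absorbsˡ {x} {t} y p = begin
    (x * y) + (0# * t)                ≈⟨ +-distribʳ (0# * t) x y ⟩
    (x + (0# * t)) * (y + (0# * t))   ≈⟨ *-congʳ p ⟩
    x * (y + (0# * t))                ≈⟨ *-distribˡ x y (0# * t) ⟩
    (x * y) + (x * (0# * t))          ≈⟨ +-congˡ (x[0y]≈0x+0y x t) ⟩
    (x * y) + ((0# * x) + (0# * t))   ≈⟨ +-congˡ (absorbs⇒0x+0t≈0x p) ⟩
    (x * y) + (0# * x)                ≈⟨ +-congˡ (*-comm 0# x) ⟩
    (x * y) + (x * 0#)                ≈⟨ xy+x0≈xy x y ⟩
    x * y                             ∎

  *-absorbsʳ : ∀ {y t} x → y Absorbs t → (x * y) Absorbs t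
  *-absorbsʳ {y} x p = absorbs-respˡ (*-comm y x) (*-absorbsˡ x p)

  absorbs-* : ∀ {x s t} → x Absorbs s → x Absorbs t → x Absorbs (s * t)
  absorbs-* {x} {s} {t} p q = begin
    x + (0# * (s * t))          ≈⟨ [x+0y]+0z≈x+0[yz] x s t ⟨
    (x + (0# * s)) + (0# * t)   ≈⟨ +-congʳ p ⟩
    x + (0# * t)                ≈⟨ q ⟩
    x                           ∎

  -- The two translations compose to one by `0# * (t * x)`, which is `0# * x` since `x` absorbs `t`.
  translate-absorbed : ∀ {x t} → x Absorbs t → ∀ y →
                       ((y + (0# * t)) + (0# * x)) ≈ (y + (0# * x))
  translate-absorbed {x} {t} p y = begin
    (y + (0# * t)) + (0# * x)   ≈⟨ [x+0y]+0z≈x+0[yz] y t x ⟩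
    y + (0# * (t * x))          ≈⟨ +-congˡ (0[xy]≈0x+0y t x) ⟩
    y + ((0# * t) + (0# * x))   ≈⟨ +-congˡ (+-comm _ _) ⟩
    y + ((0# * x) + (0# * t))   ≈⟨ +-congˡ (absorbs⇒0x+0t≈0x p) ⟩
    y + (0# * x)                ∎

  -- Associativity.

  y+x[yz]≈y+0[xz] : ∀ x y z → (y + (x * (y * z))) ≈ (y + (0# * (x * z)))
  y+x[yz]≈y+0[xz] x y z = begin
    y + (x * (y * z))               ≈⟨ +-distribˡ y x (y * z) ⟩
    -- Trading `y * z` for `0# * z` in the second factor lets the two factors recombine without the
    -- inner `y`.
    (y + x) * (y + (y * z))         ≈⟨ *-congˡ (x+xy≈x+0y y z) ⟩
    (y + x) * (y + (0# * z))        ≈⟨ +-distribˡ y x (0# * z) ⟨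
    y + (x * (0# * z))              ≈⟨ +-congˡ (x[0y]≈0x+0y x z) ⟩
    y + ((0# * x) + (0# * z))       ≈⟨ +-congˡ (0[xy]≈0x+0y x z) ⟨
    y + (0# * (x * z))              ∎

  [xy]z+x[yz]≈[xy]z : ∀ x y z → (((x * y) * z) + (x * (y * z))) ≈ ((x * y) * z)
  [xy]z+x[yz]≈[xy]z x y z = begin
    -- The translation by `o` enters at no cost, because `c` is a summand.
    c + d                                     ≈⟨ [x+y]+0x≈x+y c d ⟨
    (c + d) + o                               ≈⟨ +-congʳ (translate-xyz d) ⟩
    (((x + d) * (y + d)) * (z + d)) + o       ≈⟨ translate-* ⟩
    (((x + d) + o) * ((y + d) + o)) * ((z + d) + o)
      -- `x + d`, `y + d` and `z + d` translate `x`, `y` and `z` by `0#` times `y * z`, `x * z` and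
      -- `x * y`. As `c` absorbs these products, `o` swallows the translations.
      ≈⟨ *-cong (*-cong (swallow (x+xy≈x+0y x (y * z)) (absorbs-* c▷y c▷z))
                        (swallow (y+x[yz]≈y+0[xz] x y z) (absorbs-* c▷x c▷z)))
                (swallow (trans (+-congˡ (*-congˡ (*-comm y z))) (y+x[yz]≈y+0[xz] x z y))
                         (absorbs-* c▷x c▷y)) ⟩
    ((x + o) * (y + o)) * (z + o)             ≈⟨ translate-xyz o ⟨
    c + o                                     ≈⟨ x+0x≈x c ⟩
    c                                         ∎
    where
    c = (x * y) * z
    d = x * (y * z)
    o = 0# * c

    translate-xyz : ∀ {x y z} w → (((x * y) * z) + w) ≈ (((x + w) * (y + w)) * (z + w))
    translate-xyz w = trans (+-distribʳ w _ _) (*-congʳ (+-distribʳ w _ _))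

    translate-* = translate-xyz {x + d} {y + d} {z + d} o

    c▷x : c Absorbs x
    c▷x = *-absorbsˡ z (*-absorbsˡ y (x+0x≈x x))

    c▷y : c Absorbs y
    c▷y = *-absorbsˡ z (*-absorbsʳ x (x+0x≈x y))

    c▷z : c Absorbs z
    c▷z = *-absorbsʳ (x * y) (x+0x≈x z)

    swallow : ∀ {w t} → (w + d) ≈ (w + (0# * t)) → c Absorbs t → ((w + d) + o) ≈ (w + o)
    swallow p q = trans (+-congʳ p) (translate-absorbed q _)

  -- By commutativity, reversing the three factors interchanges the two bracketings, so their sum
  -- equals each of them.
  *-assoc : Associative _*_
  *-assoc x y z = begin
    (x * y) * z                       ≈⟨ [xy]z+x[yz]≈[xy]z x y z ⟨
    ((x * y) * z) + (x * (y * z))     ≈⟨ +-comm _ _ ⟩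
    (x * (y * z)) + ((x * y) * z)     ≈⟨ +-cong reverseˡ reverseʳ ⟩
    ((z * y) * x) + (z * (y * x))     ≈⟨ [xy]z+x[yz]≈[xy]z z y x ⟩
    (z * y) * x                       ≈⟨ reverseˡ ⟨
    x * (y * z)                       ∎
    where
    reverseˡ : (x * (y * z)) ≈ ((z * y) * x)
    reverseˡ = trans (*-comm x (y * z)) (*-congʳ (*-comm y z))

    reverseʳ : ((x * y) * z) ≈ (z * (y * x))
    reverseʳ = trans (*-comm (x * y) z) (*-congˡ (*-comm x y))

-- Duality: what is proved for `_*_` transfers to `_+_`.
IsBidistributive-swap : {A : Set a} {_≈_ : Rel A ℓ} {_+_ _*_ : Op₂ A} {0# 1# : A} →
  IsBidistributive _≈_ _+_ _*_ 0# 1# → IsBidistributive _≈_ _*_ _+_ 1# 0#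
IsBidistributive-swap B = record
  { +-isUnitalMagma = *-isUnitalMagma
  ; *-isUnitalMagma = +-isUnitalMagma
  ; +-comm          = *-comm
  ; *-comm          = +-comm
  ; *-distrib-+     = +-distrib-*
  ; +-distrib-*     = *-distrib-+
  }
  where open IsBidistributive B

-- Symmetric implication zroupoids and Birkhoff systems.

module _ (A : ImplicationZroupoid a ℓ) where

  open ImplicationZroupoid A
  open Algebra.Definitions _≈_

  private
    ≈-setoid : Setoid _ _
    ≈-setoid = record { isEquivalence = isEquivalence }

  open Setoid ≈-setoid using (refl; sym; trans)

  ′-cong : Congruent₁ _′
  ′-cong p = ⇒-cong p refl

  ∧-cong : Congruent₂ _∧_
  ∧-cong p q = ′-cong (⇒-cong p (′-cong q))

  ∨-cong : Congruent₂ _∨_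
  ∨-cong p q = ′-cong (∧-cong (′-cong p) (′-cong q))

  ∧-isMagma : IsMagma _≈_ _∧_
  ∧-isMagma = record { isEquivalence = isEquivalence ; ∙-cong = ∧-cong }

  ∨-isMagma : IsMagma _≈_ _∨_
  ∨-isMagma = record { isEquivalence = isEquivalence ; ∙-cong = ∨-cong }

  isBirkhoffSystem⇒isSymmetric : IsBirkhoffSystem (A ₘⱼ) → IsSymmetric A
  isBirkhoffSystem⇒isSymmetric B = record
    -- x ∨ x unfolds to (x ′ ∧ x ′) ′.
    { involutive = λ x → trans (sym (′-cong (Meet.idem (x ′)))) (Join.idem x)
    ; ∧-comm     = Meet.comm
    }
    where
    open IsBisemilattice (IsBirkhoffSystem.isBisemilattice B)
    module Meet = IsCommutativeBand isMeetSemilattice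
    module Join = IsCommutativeBand isJoinSemilattice

  module _ (S : IsSymmetric A) where

    open IsSymmetric S
    open ≈-Reasoning ≈-setoid

    ∨-comm : Commutative _∨_
    ∨-comm x y = ′-cong (∧-comm (x ′) (y ′))

    ∧-identityʳ : RightIdentity (0# ′) _∧_
    ∧-identityʳ x = trans (′-cong (⇒-cong refl 0′′≈0)) (involutive x)

    ∨-identityʳ : RightIdentity 0# _∨_
    ∨-identityʳ x = trans (′-cong (∧-identityʳ (x ′))) (involutive x)

    -- This lets the defining identity, stated with arrows, be read in terms of `_∨_` and `_∧_`.
    x′⇒y≈x∨y : ∀ x y → (x ′ ⇒ y) ≈ (x ∨ y)
    x′⇒y≈x∨y x y = sym (trans (involutive _) (⇒-cong refl (involutive y)))

    x∧y≈[x′∨y′]′ : ∀ x y → (x ∧ y) ≈ ((x ′ ∨ y ′) ′)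
    x∧y≈[x′∨y′]′ x y = sym (trans (involutive _) (∧-cong (involutive x) (involutive y)))

    ∨-distribʳ-∧ : _∨_ DistributesOverʳ _∧_
    ∨-distribʳ-∧ z x y = begin
      (x ∧ y) ∨ z                           ≈⟨ x′⇒y≈x∨y (x ∧ y) z ⟨
      (x ∧ y) ′ ⇒ z                         ≈⟨ ⇒-cong (involutive _) refl ⟩
      -- With `y ′` as middle argument, the right-hand side of the identity is a meet by definition.
      (x ⇒ y ′) ⇒ z                         ≈⟨ implication x (y ′) z ⟩
      (z ′ ⇒ x) ∧ (y ′ ⇒ z)                 ≈⟨ ∧-cong (x′⇒y≈x∨y z x) (x′⇒y≈x∨y y z) ⟩
      (z ∨ x) ∧ (y ∨ z)                     ≈⟨ ∧-cong (∨-comm z x) refl ⟩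
      (x ∨ z) ∧ (y ∨ z)                     ∎

    -- The De Morgan dual of `∨-distribʳ-∧`, carried over by the involution.
    ∧-distribʳ-∨ : _∧_ DistributesOverʳ _∨_
    ∧-distribʳ-∨ z x y = begin
      (x ∨ y) ∧ z                           ≈⟨ x∧y≈[x′∨y′]′ (x ∨ y) z ⟩
      ((x ∨ y) ′ ∨ z ′) ′                   ≈⟨ ′-cong (∨-cong (involutive _) refl) ⟩
      ((x ′ ∧ y ′) ∨ z ′) ′                 ≈⟨ ′-cong (∨-distribʳ-∧ (z ′) (x ′) (y ′)) ⟩
      ((x ′ ∨ z ′) ∧ (y ′ ∨ z ′)) ′         ≈⟨ ′-cong (∧-cong (deMorgan x z) (deMorgan y z)) ⟩
      (x ∧ z) ∨ (y ∧ z)                     ∎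
      where
      deMorgan : ∀ x y → (x ′ ∨ y ′) ≈ ((x ∧ y) ′)
      deMorgan x y = ′-cong (∧-cong (involutive x) (involutive y))

    ∨-∧-isBidistributive : IsBidistributive _≈_ _∨_ _∧_ 0# (0# ′)
    ∨-∧-isBidistributive = record
      { +-isUnitalMagma = record
        { isMagma = ∨-isMagma ; identity = comm∧idʳ⇒id ∨-comm ∨-identityʳ }
      ; *-isUnitalMagma = record
        { isMagma = ∧-isMagma ; identity = comm∧idʳ⇒id ∧-comm ∧-identityʳ }
      ; +-comm          = ∨-comm
      ; *-comm          = ∧-comm
      ; *-distrib-+     = comm∧distrʳ⇒distr ∨-cong ∧-comm ∧-distribʳ-∨
      ; +-distrib-*     = comm∧distrʳ⇒distr ∧-cong ∨-comm ∨-distribʳ-∧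
      }
      where open Algebra.Consequences.Setoid ≈-setoid

    isSymmetric⇒isBirkhoffSystem : IsBirkhoffSystem (A ₘⱼ)
    isSymmetric⇒isBirkhoffSystem = record
      { isBisemilattice = record
        { isMeetSemilattice = record
          { isBand = record
            { isSemigroup = record { isMagma = ∧-isMagma ; assoc = Meet.*-assoc }
            ; idem        = Meet.*-idem
            }
          ; comm = ∧-comm
          }
        ; isJoinSemilattice = record
          { isBand = record
            { isSemigroup = record { isMagma = ∨-isMagma ; assoc = Join.*-assoc }
            ; idem        = Join.*-idem
            }
          ; comm = ∨-comm
          }
        }
      ; birkhoff = Meet.x[x+y]≈x+xy
      }
      where
      module Meet = BidistributiveProperties ∨-∧-isBidistributive
      module Join = BidistributiveProperties (IsBidistributive-swap ∨-∧-isBidistributive)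

corollary4p3 : ∀ {a ℓ} (A : ImplicationZroupoid a ℓ) →
    IsBirkhoffSystem (A ₘⱼ) ⇔ IsSymmetric A
corollary4p3 A = mk⇔ (isBirkhoffSystem⇒isSymmetric A) (isSymmetric⇒isBirkhoffSystem A)
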